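{- There is an absolute constant $C$ such that for every integer $m \geq 1$ and every prime $p$ with $p \geq m^2$, $$\mathbf{E}\bigl[\mathbf{lbin}([m])\bigr] \leq C,$$ where the expectation is over a uniformly random choice of $(a,b) \in [p]^2$ and $\mathbf{lbin}([m])$ is the maximal number of elements of $[m]$ that $h_{a,b}$ maps to the same value.
   Context: For a non-negative integer $k$, $[k] = \{0, 1, \dots, k-1\}$. $p$ is a prime and $m$ is the number of bins (equal to the number of balls). For $a, b \in [p]$ the function $h_{a,b} : [p] \to [m]$ is $h_{a,b}(x) = ((ax+b) \bmod p) \bmod m$. For $S \subseteq [p]$ put $\mathbf{bin}(h_{a,b}, S, i) = |S \cap h_{a,b}^{ -1}(i)|$ for $i \in [m]$ and $\mathbf{lbin}(h_{a,b}, S) = \max_{i \in [m]} \mathbf{bin}(h_{a,b}, S, i)$. The random variable $\mathbf{lbin}(S)$ is $\mathbf{lbin}(h_{a,b}, S)$ with $(a,b)$ chosen uniformly from $[p]^2$. -}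

module Defs where

open import Algebra.Properties.Semiring.Sum using (sum)
open import Data.Fin using (Fin; toℕ; _≟_)
open import Data.Fin.Subset using (Subset; _∩_; ∣_∣)
open import Data.Integer using (+_)
open import Data.Nat using (ℕ; NonZero; _+_; _*_; _⊔_; _<?_)
open import Data.Nat.DivMod using (_%_; _mod_)
open import Data.Nat.Properties using (+-*-semiring; m*n≢0)
open import Data.Rational using (ℚ; _/_)
open import Data.Vec using (tabulate)
open import Data.Vec.Functional using (Vector; foldr)
open import Relation.Nullary using (does)

h : (p m : ℕ) .{{_ : NonZero p}} .{{_ : NonZero m}} → Fin p → Fin p → Fin p → Fin m
h p m a b x = ((toℕ a * toℕ x + toℕ b) % p) mod m

preimage : ∀ {p m} → (Fin p → Fin m) → Fin m → Subset p
preimage f i = tabulate λ x → does (f x ≟ i)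

bin : ∀ {p m} → (Fin p → Fin m) → Subset p → Fin m → ℕ
bin f S i = ∣ S ∩ preimage f i ∣

-- Starting from 0 does not affect the maximum of a nonempty family of naturals.
maximum : ∀ {n} → Vector ℕ n → ℕ
maximum = foldr _⊔_ 0

lbin : ∀ {p m} → (Fin p → Fin m) → Subset p → ℕ
lbin f S = maximum (bin f S)

-- {0, …, m-1} as a subset of {0, …, p-1}; all of the latter if m ≥ p.
initial : ∀ {p} → ℕ → Subset p
initial m = tabulate λ x → does (toℕ x <? m)

-- Expectation of X a b for (a , b) uniform on [p]².
𝔼 : ∀ {p} .{{_ : NonZero p}} → (Fin p → Fin p → ℕ) → ℚ
𝔼 {p} X = + sum +-*-semiring (λ a → sum +-*-semiring (X a)) / (p * p)
  where instance _ = m*n≢0 p p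

{-# OPTIONS --safe #-}
-- If x and y = x + d lie in a common bin of h a b, then reducing their values
-- modulo p gives two numbers below p that are congruent modulo m, so
-- a d ≡ ± m k (mod p) for some 0 ≤ k ≤ p / m.  Fixing one element x of the
-- fullest bin, lbin is thus at most twice the number of 0 ≤ d < m with this
-- property, a quantity that does not involve b.  For each d ≠ 0 there are at
-- most 2 (1 + p / m) such a, because d is invertible modulo p; hence, averaged
-- over a, that number of d is at most 1 + m · 2 (1 + p / m) / p ≤ 5.
module Submission where

open import Defs
open import Data.Nat using (ℕ; NonZero; _^_) renaming (_≤_ to _≤ℕ_)
open import Data.Nat.Primality using (Prime)
open import Data.Product using (Σ-syntax)
open import Data.Rational using (ℚ; _≤_)

open import Data.Bool using (if_then_else_; true)
open import Data.Fin as Fin using (Fin; zero; suc; toℕ; fromℕ<)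
open import Data.Fin.Properties using (suc-injective; toℕ<n; toℕ-injective; toℕ-fromℕ<)
open import Data.Fin.Subset using (Subset; ∣_∣; _∈_; inside; outside; _∩_)
open import Data.Fin.Subset.Properties using (nonempty?; Empty-unique; ∣⊥∣≡0; x∈p∩q⁻)
import Data.Integer as ℤ
import Data.Integer.Properties as ℤ
open import Data.Nat
  using (zero; suc; pred; z≤n; s≤s; _+_; _*_; _∸_; _<_; _<?_; _≟_; _/_; _%_; ∣_-_∣)
open import Data.Nat.DivMod hiding (_/_; _%_)
open import Data.Nat.Divisibility using (_∣_; divides; ∣m+n∣m⇒∣n; ∣⇒≤; n∣m*n)
open import Data.Nat.Primality using (euclidsLemma)
open import Data.Nat.Properties hiding (_≟_; _<?_; suc-injective)
open import Data.Nat.Tactic.RingSolver using (solve-∀)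
open import Data.Product using (∃-syntax; _×_; _,_; proj₁; proj₂)
import Data.Rational as ℚ
open import Data.Rational.Properties using (toℚᵘ-cancel-≤; toℚᵘ-fromℚᵘ)
open import Data.Rational.Unnormalised as ℚᵘ using (mkℚᵘ; *≤*)
import Data.Rational.Unnormalised.Properties as ℚᵘ
open import Data.Sum using (_⊎_; inj₁; inj₂)
open import Data.Vec using (_∷_; []; tabulate; here; there)
open import Data.Vec.Functional using (Vector)
open import Data.Vec.Properties using ([]=⇒lookup; lookup∘tabulate)
open import Function using (_∘_)
open import Level using (Level)
open import Relation.Binary.PropositionalEquality
open import Relation.Nullary using (¬_; Dec; yes; no; does; contradiction)
open import Relation.Unary using (Pred; Decidable)

open import Algebra.Properties.Semiring.Sum +-*-semiring
  using (sum; sum-syntax; ∑-comm; ∑-distrib-+; sum-cong-≗)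

private variable
  ℓ : Level
  n : ℕ

sum-mono-≤ : {f g : Vector ℕ n} → (∀ i → f i ≤ℕ g i) → sum f ≤ℕ sum g
sum-mono-≤ {zero}  f≤g = z≤n
sum-mono-≤ {suc n} f≤g = +-mono-≤ (f≤g zero) (sum-mono-≤ (f≤g ∘ suc))

sum-≤-const : {f : Vector ℕ n} (c : ℕ) → (∀ i → f i ≤ℕ c) → sum f ≤ℕ n * c
sum-≤-const {zero}  c f≤c = z≤n
sum-≤-const {suc n} c f≤c = +-mono-≤ (f≤c zero) (sum-≤-const c (f≤c ∘ suc))

term≤sum : (f : Vector ℕ n) (i : Fin n) → f i ≤ℕ sum f
term≤sum f zero    = m≤m+n _ _
term≤sum f (suc i) = ≤-trans (term≤sum (f ∘ suc) i) (m≤n+m _ _)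

maximum-≤ : {f : Vector ℕ n} (c : ℕ) → (∀ i → f i ≤ℕ c) → maximum f ≤ℕ c
maximum-≤ {zero}  c f≤c = z≤n
maximum-≤ {suc n} c f≤c = ⊔-lub (f≤c zero) (maximum-≤ c (f≤c ∘ suc))

∑< : ℕ → (ℕ → ℕ) → ℕ
∑< n f = ∑[ i < n ] f (toℕ i)

∑<-monoˡ-≤ : ∀ {k n} (f : ℕ → ℕ) → k ≤ℕ n → ∑< k f ≤ℕ ∑< n f
∑<-monoˡ-≤ f z≤n       = z≤n
∑<-monoˡ-≤ f (s≤s k≤n) = +-monoʳ-≤ (f 0) (∑<-monoˡ-≤ (f ∘ suc) k≤n)

∑<-last : ∀ n (f : ℕ → ℕ) → ∑< (suc n) f ≡ ∑< n f + f n
∑<-last zero    f = +-comm (f 0) 0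
∑<-last (suc n) f = begin
  f 0 + ∑< (suc n) (f ∘ suc)        ≡⟨ cong (f 0 +_) (∑<-last n (f ∘ suc)) ⟩
  f 0 + (∑< n (f ∘ suc) + f (suc n)) ≡⟨ +-assoc (f 0) _ _ ⟨
  f 0 + ∑< n (f ∘ suc) + f (suc n)   ∎
  where open ≡-Reasoning

-- As `y` varies, each distance to `x` occurs at most once on either side: `y ≤ x` gives distances
-- in `0, …, x`, and `y > x` gives distances below `n`.
∑<-∣-∣ : ∀ n x (f : ℕ → ℕ) → ∑< n (λ y → f ∣ y - x ∣) ≤ℕ ∑< (suc x) f + ∑< n f
∑<-∣-∣ n zero f = begin
  ∑< n (λ y → f ∣ y - 0 ∣) ≡⟨ sum-cong-≗ {n} (λ i → cong f (∣-∣-identityʳ (toℕ i))) ⟩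
  ∑< n f                  ≤⟨ m≤n+m _ _ ⟩
  ∑< 1 f + ∑< n f         ∎
  where open ≤-Reasoning
∑<-∣-∣ zero    (suc x) f = z≤n
∑<-∣-∣ (suc n) (suc x) f = begin
  f (suc x) + ∑< n (λ y → f ∣ y - x ∣)     ≤⟨ +-monoʳ-≤ (f (suc x)) (∑<-∣-∣ n x f) ⟩
  f (suc x) + (∑< (suc x) f + ∑< n f)     ≡⟨ +-assoc (f (suc x)) _ _ ⟨
  f (suc x) + ∑< (suc x) f + ∑< n f       ≡⟨ cong (_+ ∑< n f) (+-comm (f (suc x)) _) ⟩
  ∑< (suc x) f + f (suc x) + ∑< n f       ≡⟨ cong (_+ ∑< n f) (∑<-last (suc x) f) ⟨
  ∑< (suc (suc x)) f + ∑< n f             ≤⟨ +-monoʳ-≤ (∑< (suc (suc x)) f) (∑<-monoˡ-≤ f (n≤1+n n)) ⟩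
  ∑< (suc (suc x)) f + ∑< (suc n) f       ∎
  where open ≤-Reasoning

-- Cardinalities of subsets, and indicators.

∣∣-≤-∑< : (s : Subset n) (m : ℕ) (f : ℕ → ℕ) →
          (∀ {y} → y ∈ s → toℕ y < m × 1 ≤ℕ f (toℕ y)) → ∣ s ∣ ≤ℕ ∑< m f
∣∣-≤-∑< []            m       f q = z≤n
∣∣-≤-∑< (inside ∷ s)  zero    f q with () ← proj₁ (q here)
∣∣-≤-∑< (inside ∷ s)  (suc m) f q =
  +-mono-≤ (proj₂ (q here))
    (∣∣-≤-∑< s m (f ∘ suc) λ y∈s → ≤-pred (proj₁ (q (there y∈s))) , proj₂ (q (there y∈s)))
∣∣-≤-∑< (outside ∷ s) zero    f q =
  ∣∣-≤-∑< s 0 f λ y∈s → contradiction (proj₁ (q (there y∈s))) λ ()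
∣∣-≤-∑< (outside ∷ s) (suc m) f q = ≤-trans
  (∣∣-≤-∑< s m (f ∘ suc) λ y∈s → ≤-pred (proj₁ (q (there y∈s))) , proj₂ (q (there y∈s)))
  (m≤n+m _ (f 0))

-- Lets a bound on a bin be proved relative to a fixed element of it, since the empty bin satisfies
-- every bound.
∣∣-≤-nonempty : (s : Subset n) (c : ℕ) → (∀ {x} → x ∈ s → ∣ s ∣ ≤ℕ c) → ∣ s ∣ ≤ℕ c
∣∣-≤-nonempty {n} s c bound with nonempty? s
... | yes (x , x∈s) = bound x∈s
... | no  empty     = subst (_≤ℕ c) (sym (trans (cong ∣_∣ (Empty-unique empty)) (∣⊥∣≡0 n))) z≤n

does⇒ : {P : Set ℓ} (P? : Dec P) → does P? ≡ true → P
does⇒ (yes p) _ = p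

∈-tabulate⁻ : {P : Pred (Fin n) ℓ} (P? : Decidable P) {x : Fin n} →
              x ∈ tabulate (does ∘ P?) → P x
∈-tabulate⁻ P? {x} x∈ =
  does⇒ (P? x) (trans (sym (lookup∘tabulate (does ∘ P?) x)) ([]=⇒lookup x∈))

indicator : {P : Set ℓ} → Dec P → ℕ
indicator P? = if does P? then 1 else 0

indicator-yes : {P : Set ℓ} (P? : Dec P) → P → 1 ≤ℕ indicator P?
indicator-yes (yes _) _ = ≤-refl
indicator-yes (no ¬p) p = contradiction p ¬p

indicator-no : {P : Set ℓ} (P? : Dec P) → ¬ P → indicator P? ≤ℕ 0
indicator-no (yes p) ¬p = contradiction p ¬p
indicator-no (no _)  _  = z≤n

sum-indicator-≤1 : {P : Pred (Fin n) ℓ} (P? : Decidable P) →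
                   (∀ {i j} → P i → P j → i ≡ j) → sum (indicator ∘ P?) ≤ℕ 1
sum-indicator-≤1 {zero}  P? unique = z≤n
sum-indicator-≤1 {suc n} P? unique with P? zero
... | no  _  = sum-indicator-≤1 (P? ∘ suc) λ p q → suc-injective (unique p q)
... | yes p₀ = s≤s (≤-trans
  (sum-≤-const 0 λ i → indicator-no (P? (suc i)) λ p → contradiction (unique p₀ p) λ ())
  (≤-reflexive (*-zeroʳ n)))

-- Congruences modulo `p` and modulo `m`.

%-cancelˡ-∣ : ∀ x y p .{{_ : NonZero p}} → x % p ≡ (x + y) % p → p ∣ y
%-cancelˡ-∣ x y p eq = ∣m+n∣m⇒∣n {m = x / p * p} {n = y}
  (divides ((x + y) / p) (+-cancelˡ-≡ (x % p) _ _ (begin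
    x % p + (x / p * p + y)   ≡⟨ +-assoc (x % p) _ y ⟨
    x % p + x / p * p + y     ≡⟨ cong (_+ y) (m≡m%n+[m/n]*n x p) ⟨
    x + y                    ≡⟨ m≡m%n+[m/n]*n (x + y) p ⟩
    (x + y) % p + (x + y) / p * p ≡⟨ cong (_+ (x + y) / p * p) eq ⟨
    x % p + (x + y) / p * p ∎)))
  (n∣m*n (x / p))
  where open ≡-Reasoning

∣∧<⇒≡0 : ∀ {p e} → p ∣ e → e < p → e ≡ 0
∣∧<⇒≡0 {e = zero}  _   _   = refl
∣∧<⇒≡0 {e = suc e} p∣e e<p = contradiction (∣⇒≤ p∣e) (<⇒≱ e<p)

module _ {p : ℕ} .{{_ : NonZero p}} (prime : Prime p) where

  -- The two values differ by `(a′ ∸ a) * d`, so by Euclid's lemma `p` divides a factor. Both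
  -- factors are below `p`, so that factor is 0, and `d` is positive. The order of `a` and `a′`
  -- makes the truncated subtraction exact.
  %-affine-injective-≤ : ∀ c {a a′ d} → a ≤ℕ a′ → a′ < p → 0 < d → d < p →
                         (c + a * d) % p ≡ (c + a′ * d) % p → a ≡ a′
  %-affine-injective-≤ c {a} {a′} {d} a≤a′ a′<p 0<d d<p eq
    = conclude (euclidsLemma (a′ ∸ a) d prime
        (%-cancelˡ-∣ (c + a * d) ((a′ ∸ a) * d) p (trans eq (cong (_% p) shift))))
    where
    rearrange : ∀ a e d c → c + (a + e) * d ≡ c + a * d + e * d
    rearrange = solve-∀
    shift : c + a′ * d ≡ c + a * d + (a′ ∸ a) * d
    shift = trans (cong (λ z → c + z * d) (sym (m+[n∸m]≡n a≤a′))) (rearrange a (a′ ∸ a) d c)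
    conclude : (p ∣ a′ ∸ a) ⊎ (p ∣ d) → a ≡ a′
    conclude (inj₁ p∣e) = ≤-antisym a≤a′ (m∸n≡0⇒m≤n (∣∧<⇒≡0 p∣e (≤-<-trans (m∸n≤m a′ a) a′<p)))
    conclude (inj₂ p∣d) = contradiction (sym (∣∧<⇒≡0 p∣d d<p)) (<⇒≢ 0<d)

  %-affine-injective : ∀ c {a a′ d} → a < p → a′ < p → 0 < d → d < p →
                       (c + a * d) % p ≡ (c + a′ * d) % p → a ≡ a′
  %-affine-injective c {a} {a′} a<p a′<p 0<d d<p eq with ≤-total a a′
  ... | inj₁ a≤a′ = %-affine-injective-≤ c a≤a′ a′<p 0<d d<p eq
  ... | inj₂ a′≤a = sym (%-affine-injective-≤ c a′≤a a<p 0<d d<p (sym eq))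

%≡⇒∃* : ∀ {u v m} .{{_ : NonZero m}} → u ≤ℕ v → u % m ≡ v % m →
        ∃[ k ] (k ≤ℕ v / m × v ≡ u + m * k)
%≡⇒∃* {u} {v} {m} u≤v eq = v / m ∸ u / m , m∸n≤m (v / m) (u / m) , (begin
  v                                          ≡⟨ m≡m%n+[m/n]*n v m ⟩
  v % m + v / m * m                          ≡⟨ cong₂ (λ r q → r + q * m) (sym eq) (sym (m+[n∸m]≡n (/-monoˡ-≤ m u≤v))) ⟩
  u % m + (u / m + (v / m ∸ u / m)) * m      ≡⟨ rearrange (u % m) (u / m) (v / m ∸ u / m) m ⟩
  u % m + u / m * m + m * (v / m ∸ u / m)    ≡⟨ cong (_+ m * (v / m ∸ u / m)) (m≡m%n+[m/n]*n u m) ⟨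
  u + m * (v / m ∸ u / m)                    ∎)
  where
  open ≡-Reasoning
  rearrange : ∀ r q e m → r + (q + e) * m ≡ r + q * m + m * e
  rearrange = solve-∀

-- Both residues modulo `p` are at most `p` and agree modulo `m`, so the larger exceeds the smaller
-- by some `m * k` with `k ≤ p / m`. Hence `D` is `m * k` or its negative modulo `p`; the negative
-- case is stated additively to stay in `ℕ`.
%%≡⇒shift : ∀ A D p m .{{_ : NonZero p}} .{{_ : NonZero m}} →
            A % p % m ≡ (A + D) % p % m →
            ∃[ k ] (k ≤ℕ p / m × (D % p ≡ (m * k) % p ⊎ (m * k + D) % p ≡ 0))
%%≡⇒shift A D p m eq with ≤-total (A % p) ((A + D) % p)
... | inj₁ u≤v = let k , k≤ , v≡ = %≡⇒∃* u≤v eq in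
  k , ≤-trans k≤ (/-monoˡ-≤ m (m%n≤n (A + D) p)) , inj₁ (begin
    -- Multiples of `p` are added on both sides until the claim is an equation in `ℕ` from which
    -- `A % p` cancels.
    D % p                            ≡⟨ [m+kn]%n≡m%n D (A / p) p ⟨
    (D + A / p * p) % p              ≡⟨ cong (_% p) (+-cancelˡ-≡ (A % p) _ _ (begin
      A % p + (D + A / p * p)          ≡⟨ rearrange (A % p) D (A / p * p) ⟩
      A % p + A / p * p + D            ≡⟨ cong (_+ D) (m≡m%n+[m/n]*n A p) ⟨
      A + D                            ≡⟨ m≡m%n+[m/n]*n (A + D) p ⟩
      (A + D) % p + (A + D) / p * p    ≡⟨ cong (_+ (A + D) / p * p) v≡ ⟩
      A % p + m * k + (A + D) / p * p  ≡⟨ +-assoc (A % p) _ _ ⟩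
      A % p + (m * k + (A + D) / p * p) ∎)) ⟩
    (m * k + (A + D) / p * p) % p    ≡⟨ [m+kn]%n≡m%n (m * k) ((A + D) / p) p ⟩
    (m * k) % p                      ∎)
  where
  open ≡-Reasoning
  rearrange : ∀ x y z → x + (y + z) ≡ x + z + y
  rearrange = solve-∀
... | inj₂ v≤u = let k , k≤ , u≡ = %≡⇒∃* v≤u (sym eq) in
  k , ≤-trans k≤ (/-monoˡ-≤ m (m%n≤n A p)) , inj₂ (begin
    (m * k + D) % p                  ≡⟨ [m+kn]%n≡m%n (m * k + D) (A / p) p ⟨
    (m * k + D + A / p * p) % p      ≡⟨ cong (_% p) (+-cancelˡ-≡ ((A + D) % p) _ _ (begin
      (A + D) % p + (m * k + D + A / p * p)  ≡⟨ rearrange ((A + D) % p) (m * k) D (A / p * p) ⟩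
      (A + D) % p + m * k + A / p * p + D    ≡⟨ cong (λ u → u + A / p * p + D) u≡ ⟨
      A % p + A / p * p + D                  ≡⟨ cong (_+ D) (m≡m%n+[m/n]*n A p) ⟨
      A + D                                  ≡⟨ m≡m%n+[m/n]*n (A + D) p ⟩
      (A + D) % p + (A + D) / p * p          ∎)) ⟩
    ((A + D) / p * p) % p            ≡⟨ m*n%n≡0 ((A + D) / p) p ⟩
    0                                ∎)
  where
  open ≡-Reasoning
  rearrange : ∀ x w y z → x + (w + y + z) ≡ x + w + z + y
  rearrange = solve-∀

-- Bounding the fullest bin by a weighted count of differences.

module _ (p m : ℕ) .{{_ : NonZero p}} .{{_ : NonZero m}} where

  plus? : (a d k : ℕ) → Dec ((a * d) % p ≡ (m * k) % p)
  plus? a d k = (a * d) % p ≟ (m * k) % p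

  minus? : (a d k : ℕ) → Dec ((m * k + a * d) % p ≡ 0)
  minus? a d k = (m * k + a * d) % p ≟ 0

  -- The two signs are counted separately, so that each can be bounded by injectivity in `a`.
  solution : ℕ → ℕ → ℕ → ℕ
  solution a d k = indicator (plus? a d k) + indicator (minus? a d k)

  -- The difference 0 is a solution for every a, so it must be counted only once.
  weight : ℕ → ℕ → ℕ
  weight a zero    = 1
  weight a (suc d) = ∑< (suc (p / m)) (solution a (suc d))

  -- With `A = a * x + b` and `D = a * suc d`, the `k` from `%%≡⇒shift` indexes a positive summand
  -- of the weight. `D` does not involve `b`, so neither does the weight.
  weight-≥1-+ : ∀ a b x d → (a * x + b) % p % m ≡ (a * (x + d) + b) % p % m →
                1 ≤ℕ weight a d
  weight-≥1-+ a b x zero    eq = ≤-refl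
  weight-≥1-+ a b x (suc d) eq =
    let k , k≤ , sol = %%≡⇒shift (a * x + b) (a * suc d) p m
          (trans eq (cong (λ z → z % p % m) (rearrange a x (suc d) b)))
    in ≤-trans (subst (λ j → 1 ≤ℕ solution a (suc d) j) (sym (toℕ-fromℕ< (s≤s k≤))) (solution-≥1 sol))
               (term≤sum (solution a (suc d) ∘ toℕ) (fromℕ< (s≤s k≤)))
    where
    rearrange : ∀ a x d b → a * (x + d) + b ≡ a * x + b + a * d
    rearrange = solve-∀
    solution-≥1 : ∀ {k} → (a * suc d) % p ≡ (m * k) % p ⊎ (m * k + a * suc d) % p ≡ 0 →
                  1 ≤ℕ solution a (suc d) k
    solution-≥1 {k} (inj₁ e) = ≤-trans (indicator-yes (plus? a (suc d) k) e) (m≤m+n _ _)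
    solution-≥1 {k} (inj₂ e) = ≤-trans (indicator-yes (minus? a (suc d) k) e) (m≤n+m _ _)

  weight-≥1 : ∀ a b x y → (a * x + b) % p % m ≡ (a * y + b) % p % m →
              1 ≤ℕ weight a ∣ y - x ∣
  weight-≥1 a b x y eq with ≤-total x y
  ... | inj₁ x≤y = subst (λ d → 1 ≤ℕ weight a d) (sym (m≤n⇒∣n-m∣≡n∸m x≤y))
    (weight-≥1-+ a b x (y ∸ x) (trans eq
      (cong (λ z → (a * z + b) % p % m) (sym (m+[n∸m]≡n x≤y)))))
  ... | inj₂ y≤x = subst (λ d → 1 ≤ℕ weight a d) (sym (m≤n⇒∣m-n∣≡n∸m y≤x))
    (weight-≥1-+ a b y (x ∸ y) (trans (sym eq)
      (cong (λ z → (a * z + b) % p % m) (sym (m+[n∸m]≡n y≤x)))))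

  -- Fix `x` in a bin: every `y` in it collides with `x`, so the weight at their distance is at
  -- least 1. The two copies of the sum account for the `y` on either side of `x`.
  lbin-≤ : ∀ a b → lbin (h p m a b) (initial m) ≤ℕ ∑< m (weight (toℕ a)) + ∑< m (weight (toℕ a))
  lbin-≤ a b = maximum-≤ _ λ i →
    let s = initial m ∩ preimage (h p m a b) i in
    ∣∣-≤-nonempty s _ λ {x} x∈s → let x<m , hx≡i = ∈-bin i x∈s in begin
      ∣ s ∣                                             ≤⟨ ∣∣-≤-∑< s m (λ y → w ∣ y - toℕ x ∣)
                                                            (λ {y} y∈s → let y<m , hy≡i = ∈-bin i y∈s in
                                                              y<m , weight-≥1 (toℕ a) (toℕ b) (toℕ x) (toℕ y)
                                                                (collision (trans hx≡i (sym hy≡i)))) ⟩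
      ∑< m (λ y → w ∣ y - toℕ x ∣)                      ≤⟨ ∑<-∣-∣ m (toℕ x) w ⟩
      -- `x<m` unfolds to `suc (toℕ x) ≤ m`, which is exactly the length of the first sum.
      ∑< (suc (toℕ x)) w + ∑< m w                       ≤⟨ +-monoˡ-≤ _ (∑<-monoˡ-≤ w x<m) ⟩
      ∑< m w + ∑< m w                                   ∎
    where
    open ≤-Reasoning
    w : ℕ → ℕ
    w = weight (toℕ a)
    ∈-bin : ∀ i {x} → x ∈ initial m ∩ preimage (h p m a b) i → toℕ x < m × h p m a b x ≡ i
    ∈-bin i x∈ = let x∈S , x∈pre = x∈p∩q⁻ _ _ x∈ in
      ∈-tabulate⁻ (λ x → toℕ x <? m) x∈S , ∈-tabulate⁻ (λ x → h p m a b x Fin.≟ i) x∈pre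
    collision : ∀ {x y} → h p m a b x ≡ h p m a b y →
                (toℕ a * toℕ x + toℕ b) % p % m ≡ (toℕ a * toℕ y + toℕ b) % p % m
    -- `mod` is `fromℕ<` of the remainder, so `toℕ` recovers the remainder.
    collision eq = trans (sym (toℕ-fromℕ< _)) (trans (cong toℕ eq) (toℕ-fromℕ< _))

  -- Averaging over `a` and `b`.

  module _ (prime : Prime p) where

    -- For each sign the condition prescribes the residue of `c + a * d`, with `c` equal to 0 or
    -- `m * k`; injectivity in `a` leaves at most one `a` per sign.
    ∑-solution-≤ : ∀ {d} k → 0 < d → d < p → ∑[ a < p ] solution (toℕ a) d k ≤ℕ 2
    ∑-solution-≤ {d} k 0<d d<p = begin
      ∑[ a < p ] solution (toℕ a) d k
        ≡⟨ ∑-distrib-+ {p} _ _ ⟩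
      ∑[ a < p ] indicator (plus? (toℕ a) d k) + ∑[ a < p ] indicator (minus? (toℕ a) d k)
        ≤⟨ +-mono-≤ (sum-indicator-≤1 (λ a → plus? (toℕ a) d k) (unique 0))
                    (sum-indicator-≤1 (λ a → minus? (toℕ a) d k) (unique (m * k))) ⟩
      2 ∎
      where
      open ≤-Reasoning
      unique : ∀ c {r} {a a′ : Fin p} → (c + toℕ a * d) % p ≡ r → (c + toℕ a′ * d) % p ≡ r → a ≡ a′
      unique c {a = a} {a′} e e′ = toℕ-injective
        (%-affine-injective prime c (toℕ<n a) (toℕ<n a′) 0<d d<p (trans e (sym e′)))

    -- After exchanging the sums, `d = 0` contributes `p` and every other `d` at most
    -- `2 (1 + p / m)`. Since `m` and `m * (p / m)` are both at most `p`, the total is at most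
    -- `p + 4 p`.
    ∑∑-weight-≤ : m ≤ℕ p → ∑[ a < p ] ∑< m (weight (toℕ a)) ≤ℕ 5 * p
    ∑∑-weight-≤ m≤p = begin
      ∑[ a < p ] ∑< m (weight (toℕ a))         ≡⟨ ∑-comm {p} {m} (λ a d → weight (toℕ a) (toℕ d)) ⟩
      ∑< m (λ d → ∑[ a < p ] weight (toℕ a) d) ≤⟨ split m m≤p ⟩
      p + m * (suc (p / m) * 2)                ≡⟨ rearrange p m (p / m) ⟩
      p + (m + p / m * m) * 2                  ≤⟨ +-monoʳ-≤ p (*-monoˡ-≤ 2 (+-mono-≤ m≤p (m/n*n≤m p m))) ⟩
      p + (p + p) * 2                          ≡⟨ collect p ⟩
      5 * p                                    ∎
      where
      open ≤-Reasoning
      rearrange : ∀ p m q → p + m * (suc q * 2) ≡ p + (m + q * m) * 2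
      rearrange = solve-∀
      collect : ∀ p → p + (p + p) * 2 ≡ 5 * p
      collect = solve-∀
      nonzero : ∀ d → suc d < p → ∑[ a < p ] weight (toℕ a) (suc d) ≤ℕ suc (p / m) * 2
      nonzero d d<p = begin
        ∑[ a < p ] weight (toℕ a) (suc d)
          ≡⟨ ∑-comm {p} {suc (p / m)} (λ a k → solution (toℕ a) (suc d) (toℕ k)) ⟩
        ∑< (suc (p / m)) (λ k → ∑[ a < p ] solution (toℕ a) (suc d) k)
          ≤⟨ sum-≤-const {suc (p / m)} 2 (λ k → ∑-solution-≤ (toℕ k) (s≤s z≤n) d<p) ⟩
        suc (p / m) * 2 ∎
      -- The length is generalised from `m` to any `n ≤ p`, so that matching on it separates
      -- `d = 0`; the remaining `d` lie strictly between 0 and `p`.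
      split : ∀ n → n ≤ℕ p → ∑< n (λ d → ∑[ a < p ] weight (toℕ a) d) ≤ℕ p + n * (suc (p / m) * 2)
      split zero    _   = z≤n
      split (suc n) n<p = +-mono-≤
        (≤-trans (sum-≤-const {p} 1 (λ _ → ≤-refl)) (≤-reflexive (*-identityʳ p)))
        (≤-trans (sum-≤-const {n} _ (λ i → nonzero (toℕ i) (<-≤-trans (s≤s (toℕ<n i)) n<p)))
                 (*-monoˡ-≤ _ (n≤1+n n)))

    ∑∑-lbin-≤ : m ≤ℕ p → ∑[ a < p ] ∑[ b < p ] lbin (h p m a b) (initial m) ≤ℕ 10 * (p * p)
    ∑∑-lbin-≤ m≤p = begin
      ∑[ a < p ] ∑[ b < p ] lbin (h p m a b) (initial m)
        ≤⟨ sum-mono-≤ (λ a → sum-mono-≤ (lbin-≤ a)) ⟩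
      ∑[ a < p ] ∑[ b < p ] (w a + w a)
        -- The summand is constant in `b`; with `a` innermost, each `b` costs at most `5 p + 5 p`.
        ≡⟨ ∑-comm {p} {p} (λ a b → w a + w a) ⟩
      ∑[ b < p ] ∑[ a < p ] (w a + w a)
        ≤⟨ sum-≤-const {p} (5 * p + 5 * p) (λ _ → ≤-trans (≤-reflexive (∑-distrib-+ w w))
             (+-mono-≤ (∑∑-weight-≤ m≤p) (∑∑-weight-≤ m≤p))) ⟩
      p * (5 * p + 5 * p)
        ≡⟨ collect p ⟩
      10 * (p * p) ∎
      where
      open ≤-Reasoning
      w : Fin p → ℕ
      w a = ∑< m (weight (toℕ a))
      collect : ∀ p → p * (5 * p + 5 * p) ≡ 10 * (p * p)
      collect = solve-∀

-- From sums of naturals to the rational expectation.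

fromℚᵘ-mono-≤ : ∀ {x y} → x ℚᵘ.≤ y → ℚ.fromℚᵘ x ≤ ℚ.fromℚᵘ y
fromℚᵘ-mono-≤ {x} {y} x≤y = toℚᵘ-cancel-≤ (begin
  ℚ.toℚᵘ (ℚ.fromℚᵘ x) ≃⟨ toℚᵘ-fromℚᵘ x ⟩
  x                   ≤⟨ x≤y ⟩
  y                   ≃⟨ toℚᵘ-fromℚᵘ y ⟨
  ℚ.toℚᵘ (ℚ.fromℚᵘ y) ∎)
  where open ℚᵘ.≤-Reasoning

-- The comparison is made between unnormalised fractions, where the order is cross-multiplication
-- and no gcd has to be handled.
𝔼-≤ : ∀ {p} .{{_ : NonZero p}} (X : Fin p → Fin p → ℕ) c →
      ∑[ a < p ] ∑[ b < p ] X a b ≤ℕ c * (p * p) → 𝔼 X ≤ ℤ.+ c ℚ./ 1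
𝔼-≤ {suc p} X c bound = fromℚᵘ-mono-≤
  -- `mkℚᵘ` stores the denominator minus one, hence `pred` here and the 0 for denominator 1.
  {mkℚᵘ (ℤ.+ total) (pred (suc p * suc p))} {mkℚᵘ (ℤ.+ c) 0}
  (*≤* (subst₂ ℤ._≤_ (ℤ.pos-* total 1) (ℤ.pos-* c (suc p * suc p))
    (ℤ.+≤+ (≤-trans (≤-reflexive (*-identityʳ total)) bound))))
  where
  total : ℕ
  total = ∑[ a < suc p ] ∑[ b < suc p ] X a b

theorem1 : Σ[ C ∈ ℚ ] (∀ (m p : ℕ) .{{_ : NonZero m}} .{{_ : NonZero p}} → Prime p → m ^ 2 ≤ℕ p →
    𝔼 (λ a b → lbin (h p m a b) (initial m)) ≤ C)
theorem1 = ℤ.+ 10 ℚ./ 1 , λ m p prime m²≤p →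
  𝔼-≤ (λ a b → lbin (h p m a b) (initial m)) 10
    -- `m ^ 2` unfolds to `m * (m * 1)`, which is at least `m` because `m * 1` is nonzero.
    (∑∑-lbin-≤ p m prime (≤-trans (m≤m*n m (m * 1) {{m*n≢0 m 1}}) m²≤p))
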